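{- Let $n=2r+1\ge 5$. Let $\mathcal H$ be a simple $n$-vertex hypergraph containing a Hamiltonian Berge cycle $C=v_0e_0v_1e_1\cdots v_{n-1}e_{n-1}v_0$. Let $\mathcal G\subseteq E(\mathcal H)$ satisfy $E(C)\subseteq\mathcal G$, and suppose that every hyperedge in $\mathcal G$ has size at least $r$. If $D\subseteq\{2,\dots,r\}$ and $|\mathcal G|\ge n+|D|$, then there is a Hamiltonian Berge cycle $C_D$ with the same vertex sequence $v_0,v_1,\dots,v_{n-1}$ and with edge set contained in $\mathcal G$, together with distinct hyperedges $g_d\in\mathcal G\setminus E(C_D)$, one for each $d\in D$, such that $g_d$ realizes cyclic distance $d$.
   Context: All hypergraphs are finite and simple: the edge family consists of distinct subsets of the vertex set. A Berge cycle of length $\ell\ge 2$ is an alternating sequence $x_0h_0x_1h_1\cdots x_{\ell-1}h_{\ell-1}x_0$ with distinct vertices $x_i$, distinct hyperedges $h_i$, and $\{x_i,x_{i+1}\}\subseteq h_i$ for every $i$ (indices modulo $\ell$); its edge set is $E(C)=\{h_0,\dots,h_{\ell-1}\}$. It is Hamiltonian if it contains every vertex. Relative to the displayed cyclic order $v_0,\dots,v_{n-1}$, a hyperedge $h$ realizes cyclic distance $d$ if it contains a pair $\{v_i,v_{i+d}\}$ for some $i$ (indices modulo $n$). -}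

module Defs where

open import Data.Fin using (Fin; toℕ)
open import Data.Fin.Subset using (Subset; _∈_)
open import Data.Nat using (ℕ; suc; _+_; _≤_)
open import Data.Nat.DivMod using (_mod_)
open import Data.Product using (_×_; ∃-syntax)
open import Function.Definitions using (Injective; StrictlySurjective)
open import Level using (0ℓ)
open import Relation.Binary.PropositionalEquality using (_≡_)
open import Relation.Unary using (Pred)

-- The vertex set is Fin n.  The edge family is enumerated without repetition,
-- so a set of hyperedges is a Subset size and its cardinality is ∣_∣.
record Hypergraph (n : ℕ) : Set where
  field
    size   : ℕ
    edge   : Fin size → Subset n
    simple : Injective _≡_ _≡_ edge

open Hypergraph public

-- Addition of indices modulo ℓ.
infixl 6 _⊕_

_⊕_ : ∀ {ℓ} → Fin ℓ → ℕ → Fin ℓ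
_⊕_ {suc k} i d = (toℕ i + d) mod suc k

record BergeCycle {n : ℕ} (H : Hypergraph n) (ℓ : ℕ) : Set where
  field
    length≥2            : 2 ≤ ℓ
    vertex              : Fin ℓ → Fin n
    hyperedge           : Fin ℓ → Fin (size H)
    vertex-injective    : Injective _≡_ _≡_ vertex
    hyperedge-injective : Injective _≡_ _≡_ hyperedge
    incident            : ∀ i → vertex i ∈ edge H (hyperedge i)
                              × vertex (i ⊕ 1) ∈ edge H (hyperedge i)

open BergeCycle public

E : ∀ {n ℓ} {H : Hypergraph n} → BergeCycle H ℓ → Pred (Fin (size H)) 0ℓ
E C h = ∃[ i ] hyperedge C i ≡ h

Hamiltonian : ∀ {n ℓ} {H : Hypergraph n} → BergeCycle H ℓ → Set
Hamiltonian C = StrictlySurjective _≡_ (vertex C)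

-- The cyclic order is the sequence v.
Realizes : ∀ {n ℓ} → (Fin ℓ → Fin n) → Subset n → ℕ → Set
Realizes v h d = ∃[ i ] (v i ∈ h × v (i ⊕ d) ∈ h)

{-# OPTIONS --safe #-}
-- The distances d ∈ D are treated one at a time.  Counting gives a hyperedge u ∈ 𝒢 that is neither
-- on the cycle nor chosen before.  If u realizes d, choose it.  Otherwise note how rigid u is: a set
-- S ⊆ ℤ/n of size at least r without a pair at distance d alternates along the steps of length d,
-- except at one gap z, because n = 2r + 1.  So S is determined by z, up to translation it depends
-- only on d, and as d ≥ 2 it contains consecutive positions z + t, z + t + 1 for an offset t
-- depending only on d.  Put u in the place of the cycle hyperedge joining v_{z+t} to v_{z+t+1},
-- which becomes the new u, and repeat.  Different hyperedges missing d have different gaps, hence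
-- are put in different places, so the process ends, and it ends with a u that realizes d.
module Submission where

open import Defs
open import Data.Bool using (Bool; true; false; not)
import Data.Bool.Properties as Bool
open import Data.Bool.Properties using (not-involutive; not-¬; ¬-not)
open import Data.Empty using (⊥)
open import Data.Fin using (Fin; zero; suc; toℕ; fromℕ<; inject≤; splitAt; join; _↑ˡ_; _↑ʳ_)
open import Data.Fin.Properties using (toℕ-injective; toℕ-fromℕ<; toℕ<n; toℕ≤n; toℕ≤pred[n]; suc-injective; inject≤-injective; injective⇒≤; join-splitAt; splitAt-↑ˡ; splitAt-↑ʳ; any?; _≟_)
open import Data.Fin.Subset using (Subset; _∈_; ∣_∣; _∪_; _⊃_; ⁅_⁆) renaming (⊥ to ∅)
open import Data.Fin.Subset.Induction using (Acc; acc; ⊃-wellFounded)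
open import Data.Fin.Subset.Properties using (_∈?_; ∉⊥; ⊆-antisym; p⊆p∪q; q⊆p∪q; x∈p∪q⁻; x∈⁅x⁆; x∈⁅y⁆⇒x≡y)
open import Data.Nat using (ℕ; zero; suc; _+_; _*_; _∸_; _≤_; _<_; _≥_; z≤n; s≤s; NonZero; _%_)
open import Data.Nat.DivMod using (_mod_; m%n<n; %-distribˡ-+; m%n%n≡m%n; [m+kn]%n≡m%n; m<n⇒m%n≡m)
open import Data.Nat.Properties using (≤-trans; ≤-reflexive; <⇒≤; <⇒≱; m≤n⇒m≤1+n; n≤1+n; m∸n+n≡m; m+[n∸m]≡n; +-assoc; +-comm; +-suc; +-identityʳ; *-comm; *-suc; *-distribʳ-+; +-mono-≤; *-cancelʳ-<; m<m+n; m≤m*n; *-monoˡ-≤)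
open import Data.Product using (_×_; _,_; proj₁; proj₂; ∃; ∃₂; Σ-syntax)
open import Data.Sum using (_⊎_; inj₁; inj₂; [_,_]′)
open import Data.Vec using (_∷_; here; there; lookup)
open import Data.Vec.Properties using ([]=⇒lookup; lookup⇒[]=)
import Data.Vec.Functional as Vector
open import Data.Vec.Functional.Properties using (updateAt-updates; updateAt-minimal)
open import Function using (_∘_; const)
open import Function.Definitions using (Injective; StrictlySurjective)
open import Relation.Binary.PropositionalEquality using (_≡_; _≢_; refl; sym; trans; cong; subst; module ≡-Reasoning)
open import Relation.Nullary using (¬_; Dec; yes; no; contradiction; _×-dec_)
open import Relation.Unary using (_⊆_; _∉_; Decidable)

-- Injections and pigeonhole

∷-injective : ∀ {A : Set} {k} {x : A} {f : Fin k → A} → Injective _≡_ _≡_ f →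
  (∀ i → f i ≢ x) → Injective _≡_ _≡_ (x Vector.∷ f)
∷-injective f-inj fresh {zero}  {zero}  _  = refl
∷-injective f-inj fresh {zero}  {suc j} eq = contradiction (sym eq) (fresh j)
∷-injective f-inj fresh {suc i} {zero}  eq = contradiction eq (fresh i)
∷-injective f-inj fresh {suc i} {suc j} eq = cong suc (f-inj eq)

++-injective : ∀ {A : Set} {k l} {f : Fin k → A} {g : Fin l → A} →
  Injective _≡_ _≡_ f → Injective _≡_ _≡_ g → (∀ i j → f i ≢ g j) →
  Injective _≡_ _≡_ (f Vector.++ g)
++-injective {k = k} {l} {f} {g} f-inj g-inj disjoint {i} {j} eq =
  trans (sym (join-splitAt k l i)) (trans (cong (join k l) (sums (splitAt k i) (splitAt k j) eq)) (join-splitAt k l j))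
  where
  sums : ∀ s t → [ f , g ]′ s ≡ [ f , g ]′ t → s ≡ t
  sums (inj₁ a) (inj₁ b) e = cong inj₁ (f-inj e)
  sums (inj₁ a) (inj₂ b) e = contradiction e (disjoint a b)
  sums (inj₂ a) (inj₁ b) e = contradiction (sym e) (disjoint b a)
  sums (inj₂ a) (inj₂ b) e = cong inj₂ (g-inj e)

element : ∀ {s} (p : Subset s) → Fin ∣ p ∣ → Fin s
element (true  ∷ p) zero    = zero
element (true  ∷ p) (suc i) = suc (element p i)
element (false ∷ p) i       = suc (element p i)

element-∈ : ∀ {s} (p : Subset s) i → element p i ∈ p
element-∈ (true  ∷ p) zero    = here
element-∈ (true  ∷ p) (suc i) = there (element-∈ p i)
element-∈ (false ∷ p) i       = there (element-∈ p i)

element-injective : ∀ {s} (p : Subset s) → Injective _≡_ _≡_ (element p)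
element-injective (true  ∷ p) {zero}  {zero}  eq = refl
element-injective (true  ∷ p) {suc i} {suc j} eq = cong suc (element-injective p (suc-injective eq))
element-injective (false ∷ p)                 eq = element-injective p (suc-injective eq)

index : ∀ {s} {p : Subset s} {x} → x ∈ p → Fin ∣ p ∣
index {p = true  ∷ p} here      = zero
index {p = true  ∷ p} (there m) = suc (index m)
index {p = false ∷ p} (there m) = index m

element-index : ∀ {s} {p : Subset s} {x} (x∈p : x ∈ p) → element p (index x∈p) ≡ x
element-index {p = true  ∷ p} here      = refl
element-index {p = true  ∷ p} (there m) = cong suc (element-index m)
element-index {p = false ∷ p} (there m) = cong suc (element-index m)

∃-outside-image : ∀ {m s} (f : Fin m → Fin s) (p : Subset s) → m < ∣ p ∣ →
  ∃ λ u → u ∈ p × (∀ j → f j ≢ u)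
∃-outside-image {m} f p m<∣p∣ with any? (λ i → missed? (element p i))
  where
  missed? : ∀ u → Dec (∀ j → f j ≢ u)
  missed? u with any? (λ j → f j ≟ u)
  ... | yes (j , eq) = no (λ fresh → fresh j eq)
  ... | no  none     = yes (λ j eq → none (j , eq))
... | yes (i , fresh) = element p i , element-∈ p i , fresh
... | no  none        = contradiction (injective⇒≤ preimage-injective) (<⇒≱ m<∣p∣)
  where
  hit : ∀ i → ∃ λ j → f j ≡ element p i
  hit i with any? (λ j → f j ≟ element p i)
  ... | yes h = h
  ... | no ¬h = contradiction (i , λ j eq → ¬h (j , eq)) none
  preimage-injective : Injective _≡_ _≡_ (proj₁ ∘ hit)
  preimage-injective {i} {j} eq =
    element-injective p (trans (sym (proj₂ (hit i))) (trans (cong f eq) (proj₂ (hit j))))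

-- Cyclic shifts

toℕ-mod : ∀ x n .{{_ : NonZero n}} → toℕ (x mod n) ≡ x % n
toℕ-mod x n = toℕ-fromℕ< (m%n<n x n)

⊕-assoc : ∀ {n} (i : Fin n) a b → i ⊕ a ⊕ b ≡ i ⊕ (a + b)
⊕-assoc {n@(suc _)} i a b = toℕ-injective (begin
  toℕ (i ⊕ a ⊕ b)                   ≡⟨ toℕ-mod (toℕ (i ⊕ a) + b) n ⟩
  (toℕ (i ⊕ a) + b) % n             ≡⟨ cong (λ x → (x + b) % n) (toℕ-mod (toℕ i + a) n) ⟩
  ((toℕ i + a) % n + b) % n         ≡⟨ %-distribˡ-+ ((toℕ i + a) % n) b n ⟩
  ((toℕ i + a) % n % n + b % n) % n ≡⟨ cong (λ x → (x + b % n) % n) (m%n%n≡m%n (toℕ i + a) n) ⟩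
  ((toℕ i + a) % n + b % n) % n     ≡⟨ %-distribˡ-+ (toℕ i + a) b n ⟨
  (toℕ i + a + b) % n               ≡⟨ cong (_% n) (+-assoc (toℕ i) a b) ⟩
  (toℕ i + (a + b)) % n             ≡⟨ toℕ-mod (toℕ i + (a + b)) n ⟨
  toℕ (i ⊕ (a + b))                 ∎)
  where open ≡-Reasoning

⊕-comm : ∀ {n} (i : Fin n) a b → i ⊕ a ⊕ b ≡ i ⊕ b ⊕ a
⊕-comm i a b = trans (⊕-assoc i a b) (trans (cong (i ⊕_) (+-comm a b)) (sym (⊕-assoc i b a)))

⊕-period : ∀ {n} (i : Fin n) k → i ⊕ (k * n) ≡ i
⊕-period {n@(suc _)} i k = toℕ-injective (begin
  toℕ (i ⊕ (k * n))   ≡⟨ toℕ-mod (toℕ i + k * n) n ⟩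
  (toℕ i + k * n) % n ≡⟨ [m+kn]%n≡m%n (toℕ i) k n ⟩
  toℕ i % n           ≡⟨ m<n⇒m%n≡m (toℕ<n i) ⟩
  toℕ i               ∎)
  where open ≡-Reasoning

⊕-connects : ∀ {n} (i j : Fin n) → ∃ λ k → i ⊕ k ≡ j
⊕-connects {n@(suc _)} i j = n ∸ toℕ i + toℕ j , toℕ-injective (begin
  toℕ (i ⊕ (n ∸ toℕ i + toℕ j))         ≡⟨ toℕ-mod (toℕ i + (n ∸ toℕ i + toℕ j)) n ⟩
  (toℕ i + (n ∸ toℕ i + toℕ j)) % n     ≡⟨ cong (_% n) (+-assoc (toℕ i) (n ∸ toℕ i) (toℕ j)) ⟨
  (toℕ i + (n ∸ toℕ i) + toℕ j) % n     ≡⟨ cong (λ x → (x + toℕ j) % n) (m+[n∸m]≡n (toℕ≤n i)) ⟩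
  (n + toℕ j) % n                       ≡⟨ cong (_% n) (+-comm n (toℕ j)) ⟩
  (toℕ j + n) % n                       ≡⟨ cong (λ x → (toℕ j + x) % n) (+-identityʳ n) ⟨
  (toℕ j + 1 * n) % n                   ≡⟨ [m+kn]%n≡m%n (toℕ j) 1 n ⟩
  toℕ j % n                             ≡⟨ m<n⇒m%n≡m (toℕ<n j) ⟩
  toℕ j                                 ∎)
  where open ≡-Reasoning

⊕-injective : ∀ {n} a → Injective _≡_ _≡_ (λ (i : Fin n) → i ⊕ a)
⊕-injective {n@(suc k)} a {i} {j} eq = trans (sym (back i)) (trans (cong (_⊕ (a * k)) eq) (back j))
  where
  -- Shifting by `a` and then by `a * k` makes `a` full turns, because `n = suc k`.
  back : ∀ (x : Fin n) → x ⊕ a ⊕ (a * k) ≡ x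
  back x = trans (⊕-assoc x a (a * k)) (trans (cong (x ⊕_) (sym (*-suc a k))) (⊕-period x a))

-- Shifts commute, so the fixed point can be moved from `i` to `zero`, whose shift by `k < n` has
-- value `k`.
⊕-fixed⇒≡0 : ∀ {n} (i : Fin n) {k} → k < n → i ⊕ k ≡ i → k ≡ 0
⊕-fixed⇒≡0 {n@(suc _)} i {k} k<n fixed with ⊕-connects i zero
... | a , i⊕a≡0 = trans (sym (m<n⇒m%n≡m k<n)) (trans (sym (toℕ-mod k n)) (cong toℕ 0⊕k≡0))
  where
  0⊕k≡0 : zero ⊕ k ≡ zero {n = n ∸ 1}
  0⊕k≡0 = trans (cong (_⊕ k) (sym i⊕a≡0)) (trans (⊕-comm i a k) (trans (cong (_⊕ a) fixed) i⊕a≡0))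

walk : ∀ {n} → ℕ → ℕ → Fin n → Fin n
walk d zero    x = x
walk d (suc k) x = walk d k x ⊕ d

walk-⊕ : ∀ {n} d k (x : Fin n) → walk d k x ≡ x ⊕ (k * d)
walk-⊕ d zero    x = sym (⊕-period x 0)
walk-⊕ d (suc k) x = trans (cong (_⊕ d) (walk-⊕ d k x))
  (trans (⊕-assoc x (k * d) d) (cong (x ⊕_) (+-comm (k * d) d)))

walk-closes : ∀ {n} d (x : Fin n) → walk d n x ≡ x
walk-closes {n} d x = trans (walk-⊕ d n x) (trans (cong (x ⊕_) (*-comm n d)) (⊕-period x d))

-- Vertex sets of odd cycles without a pair at a given distance

Misses : ∀ {n} → (Fin n → Bool) → ℕ → Set
Misses m d = ∀ i → m i ≡ true → m (i ⊕ d) ≡ false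

-- Size is witnessed by an injection, so that counting arguments become injections into `Fin n`.
Large : ∀ {n} → ℕ → (Fin n → Bool) → Set
Large {n} r m = Σ[ s ∈ (Fin r → Fin n) ] Injective _≡_ _≡_ s × (∀ j → m (s j) ≡ true)

record Alternates {n} (m : Fin n → Bool) (d : ℕ) (z : Fin n) : Set where
  field
    gap   : m z ≡ false
    gap⁺  : m (z ⊕ d) ≡ false
    flips : ∀ y → y ≢ z → m (y ⊕ d) ≡ not (m y)

open Alternates

-- The walk is back at `x` after `n` steps, even if its orbit is shorter than `n`. As `n` is odd,
-- `n` flips would turn `m x` into its own negation.
no-odd-alternation : ∀ {n r} → n ≡ 2 * r + 1 → (m : Fin n → Bool) (d : ℕ) (x : Fin n) →
  ¬ (∀ k → k < n → m (walk d (suc k) x) ≡ not (m (walk d k x)))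
no-odd-alternation {n} {r} n≡2r+1 m d x alt =
  not-¬ {m x} refl (trans (cong m (sym (walk-closes d x))) (trans (cong (λ k → m (walk d k x)) n≡1+r*2)
    (trans (alt (r * 2) (≤-reflexive (sym n≡1+r*2))) (cong not (even r (≤-reflexive (sym n≡1+r*2)))))))
  where
  n≡1+r*2 : n ≡ suc (r * 2)
  n≡1+r*2 = trans n≡2r+1 (trans (+-comm (2 * r) 1) (cong suc (*-comm 2 r)))
  even : ∀ k → k * 2 < n → m (walk d (k * 2) x) ≡ m x
  even zero    _ = refl
  even (suc k) l = trans (alt (suc (k * 2)) (<⇒≤ l))
    (trans (cong not (alt (k * 2) (<⇒≤ (<⇒≤ l))))
    (trans (not-involutive (m (walk d (k * 2) x))) (even k (<⇒≤ (<⇒≤ l)))))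

Gap : ∀ {n} → (Fin n → Bool) → ℕ → Fin n → Set
Gap m d z = m z ≡ false × m (z ⊕ d) ≡ false

gap? : ∀ {n} (m : Fin n → Bool) d → Decidable (Gap m d)
gap? m d z = m z Bool.≟ false ×-dec m (z ⊕ d) Bool.≟ false

¬gap⇒flips : ∀ {n} {m : Fin n → Bool} {d} → Misses m d → ∀ y → ¬ Gap m d y → m (y ⊕ d) ≡ not (m y)
¬gap⇒flips {m = m} {d} misses y ¬gap with m y in eq
... | true  = misses y eq
... | false = ¬-not (λ e → ¬gap (refl , e))

-- m and its translate by d are disjoint and together cover all but one position.
gap-unique : ∀ {n r} → n ≡ 2 * r + 1 → {m : Fin n → Bool} {d : ℕ} → Large r m → Misses m d →
  ∀ {y z} → Gap m d y → Gap m d z → y ≡ z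
gap-unique {n} {r} n≡2r+1 {m} {d} (s , s-inj , s∈m) misses {y} {z} (y∉ , y+∉) (z∉ , z+∉) with y ≟ z
... | yes y≡z = y≡z
... | no  y≢z = contradiction (injective⇒≤ four-injective) (<⇒≱ (≤-reflexive (cong suc count)))
  where
  apart : ∀ {a b} → m a ≡ true → m b ≡ false → a ≢ b
  apart a∈ b∉ refl with trans (sym a∈) b∉
  ... | ()
  s⁺ : Fin r → Fin n
  s⁺ j = s j ⊕ d
  -- The extra position is `w ⊕ d` rather than `w`: a gap `w` may itself be a translate of a member
  -- of `m`, whereas `w ⊕ d` is not, because `w` is outside `m`.
  outside : ∀ {w} → m w ≡ false → m (w ⊕ d) ≡ false → ∀ j → (s Vector.++ s⁺) j ≢ w ⊕ d
  outside w∉ w+∉ j with splitAt r j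
  ... | inj₁ a = apart (s∈m a) w+∉
  ... | inj₂ a = apart (s∈m a) w∉ ∘ ⊕-injective d
  three-injective : Injective _≡_ _≡_ ((y ⊕ d) Vector.∷ (s Vector.++ s⁺))
  three-injective = ∷-injective
    (++-injective s-inj (s-inj ∘ ⊕-injective d) (λ i j → apart (s∈m i) (misses (s j) (s∈m j))))
    (outside y∉ y+∉)
  four-injective : Injective _≡_ _≡_ ((z ⊕ d) Vector.∷ ((y ⊕ d) Vector.∷ (s Vector.++ s⁺)))
  four-injective = ∷-injective three-injective
    λ { zero → y≢z ∘ ⊕-injective d ; (suc j) → outside z∉ z+∉ j }
  count : n ≡ suc (r + r)
  count = trans n≡2r+1 (trans (+-comm (2 * r) 1) (cong (λ x → suc (r + x)) (+-identityʳ r)))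

-- A step that does not flip starts at a gap. Parity forces at least one gap and counting allows at
-- most one.
misses⇒alternates : ∀ {n r} → n ≡ 2 * r + 1 → {m : Fin n → Bool} {d : ℕ} → Large r m → Misses m d →
  ∃ (Alternates m d)
misses⇒alternates {n} {r} odd {m} {d} large misses with any? (gap? m d)
... | yes (z , gz@(z∉ , z+∉)) = z , record
  { gap   = z∉
  ; gap⁺  = z+∉
  ; flips = λ y y≢z → ¬gap⇒flips {m = m} misses y (λ gy → y≢z (gap-unique odd large misses gy gz))
  }
... | no none = contradiction (λ k _ → ¬gap⇒flips {m = m} misses (walk d k x) (λ g → none (_ , g)))
                              (no-odd-alternation {r = r} odd m d x)
  where
  x : Fin n
  x = subst Fin (trans (+-comm 1 (2 * r)) (sym odd)) zero

-- By parity the walk from `x` must meet `z`, also when `d` and `n` share a factor. Both sets are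
-- known at `z`, and each further step fixes the next value, until the walk is back at `x`.
alternates-unique : ∀ {n r} → n ≡ 2 * r + 1 → {m m′ : Fin n → Bool} {d : ℕ} {z : Fin n} →
  Alternates m d z → Alternates m′ d z → ∀ x → m x ≡ m′ x
alternates-unique {n} {r} odd {m} {m′} {d} {z} A A′ x with any? (λ j → walk d (toℕ j) x ≟ z)
... | no never = contradiction (λ k k<n → flips A (walk d k x) (avoids k k<n))
                               (no-odd-alternation {r = r} odd m d x)
  where
  avoids : ∀ k → k < n → walk d k x ≢ z
  avoids k k<n eq = never (fromℕ< k<n , trans (cong (λ j → walk d j x) (toℕ-fromℕ< k<n)) eq)
... | yes (j , eq) = subst Agree (trans (cong (λ k → walk d k x) (m∸n+n≡m (toℕ≤n j))) (walk-closes d x))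
                                 (forward (n ∸ toℕ j))
  where
  Agree : Fin n → Set
  Agree y = m y ≡ m′ y
  step : ∀ y → Agree y → Agree (y ⊕ d)
  step y e with y ≟ z
  -- `flips` says nothing about the step out of `z`; `gap⁺` supplies that value.
  ... | yes refl = trans (gap⁺ A) (sym (gap⁺ A′))
  ... | no  y≢z  = trans (flips A y y≢z) (trans (cong not e) (sym (flips A′ y y≢z)))
  forward : ∀ k → Agree (walk d (k + toℕ j) x)
  forward zero    = subst Agree (sym eq) (trans (gap A) (sym (gap A′)))
  forward (suc k) = step _ (forward k)

alternates-translate : ∀ {n} {m : Fin n → Bool} {d} {z} t → Alternates m d (z ⊕ t) →
  Alternates (λ x → m (x ⊕ t)) d z
alternates-translate {m = m} {d} {z} t A = record
  { gap   = gap A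
  ; gap⁺  = trans (cong m (⊕-comm z d t)) (gap⁺ A)
  ; flips = λ y y≢z → trans (cong m (⊕-comm y d t)) (flips A (y ⊕ t) (y≢z ∘ ⊕-injective t))
  }

-- A set missing distance 1 contains z+2, z+4, …, z+2r, where z is its gap.
evens : ∀ {n} {m : Fin n → Bool} {z} → Alternates m 1 z →
  ∀ j → suc (j * 2) < n → m (z ⊕ (2 + j * 2)) ≡ true
evens {n} {m} {z} A = go
  where
  next : ∀ k → suc k < n → m (z ⊕ suc (suc k)) ≡ not (m (z ⊕ suc k))
  next k l = trans (cong m (trans (cong (z ⊕_) (+-comm 1 (suc k))) (sym (⊕-assoc z (suc k) 1))))
    (flips A (z ⊕ suc k) (λ fixed → contradiction (⊕-fixed⇒≡0 z l fixed) (λ ())))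
  go : ∀ j → suc (j * 2) < n → m (z ⊕ (2 + j * 2)) ≡ true
  go zero    l = trans (next 0 l) (cong not (gap⁺ A))
  go (suc j) l = trans (next (2 + j * 2) l) (cong not (trans (next (suc (j * 2)) (<⇒≤ l)) (cong not (go j (<⇒≤ (<⇒≤ l))))))

even⊎odd : ∀ d → ∃ λ e → d ≡ e * 2 ⊎ d ≡ suc (e * 2)
even⊎odd zero = 0 , inj₁ refl
even⊎odd (suc d) with even⊎odd d
... | e , inj₁ eq = e , inj₂ (cong suc eq)
... | e , inj₂ eq = suc e , inj₁ (cong suc eq)

-- Among the members z+2, z+4, ..., z+2r given by `evens`, two are at cyclic distance `d`: directly
-- if `d` is even, and across the end of the cycle if `d` is odd, since then `n - d` is even.
misses-1⇒¬misses : ∀ {n r} → n ≡ 2 * r + 1 → {m : Fin n → Bool} {d : ℕ} → 2 ≤ d → d ≤ r →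
  Large r m → Misses m 1 → ¬ Misses m d
misses-1⇒¬misses {n} {r} odd {m} {d} 2≤d d≤r large misses₁ misses
  with misses⇒alternates odd large misses₁ | even⊎odd d
... | z , A | e , parity = cases e parity
  where
  bound : ∀ j → j < r → suc (j * 2) < n
  bound j j<r = subst (2 + j * 2 ≤_) (sym (trans odd (+-comm (2 * r) 1)))
    (m≤n⇒m≤1+n (subst (2 + j * 2 ≤_) (*-comm r 2) (*-monoˡ-≤ 2 j<r)))
  clash : ∀ j j′ → j < r → j′ < r → z ⊕ (2 + j * 2) ⊕ d ≡ z ⊕ (2 + j′ * 2) → ⊥
  clash j j′ j<r j′<r eq
    with trans (sym (misses (z ⊕ (2 + j * 2)) (evens A j (bound j j<r))))
               (trans (cong m eq) (evens A j′ (bound j′ j′<r)))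
  ... | ()
  cases : ∀ e → d ≡ e * 2 ⊎ d ≡ suc (e * 2) → ⊥
  cases e (inj₁ d≡2e) = clash 0 e (≤-trans (<⇒≤ 2≤d) d≤r) e<r
    (trans (⊕-assoc z 2 d) (cong (λ x → z ⊕ (2 + x)) d≡2e))
    where
    e<r : e < r
    e<r = *-cancelʳ-< 2 e r (subst (_< r * 2) d≡2e
      (≤-trans (+-mono-≤ (≤-trans (<⇒≤ 2≤d) d≤r) d≤r)
        (≤-reflexive (trans (cong (r +_) (sym (+-identityʳ r))) (*-comm 2 r)))))
  -- For `d = 1` the difference `n - d = 2r` would exceed the largest one available, `2r - 2`, so
  -- `2 ≤ d` has to exclude this case.
  cases zero (inj₂ refl) = contradiction 2≤d λ { (s≤s ()) }
  -- `r ∸ suc e` is half of `n - d`, so adding `d` completes a full turn and lands on `z ⊕ 2`.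
  cases (suc e) (inj₂ d≡2e+1) = clash (r ∸ suc e) 0 w<r (≤-trans (<⇒≤ 2≤d) d≤r) (begin
    z ⊕ (2 + (r ∸ suc e) * 2) ⊕ d                   ≡⟨ ⊕-assoc z _ d ⟩
    z ⊕ (2 + (r ∸ suc e) * 2 + d)                   ≡⟨ cong (λ x → z ⊕ (2 + (r ∸ suc e) * 2 + x)) d≡2e+1 ⟩
    z ⊕ (2 + ((r ∸ suc e) * 2 + suc (suc e * 2)))   ≡⟨ cong (λ x → z ⊕ (2 + x)) wrap ⟩
    z ⊕ (2 + 1 * n)                                 ≡⟨ ⊕-assoc z 2 (1 * n) ⟨
    z ⊕ 2 ⊕ (1 * n)                                 ≡⟨ ⊕-period (z ⊕ 2) 1 ⟩
    z ⊕ 2                                           ∎)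
    where
    open ≡-Reasoning
    w+e+1≡r : r ∸ suc e + suc e ≡ r
    w+e+1≡r = m∸n+n≡m (≤-trans (m≤m*n (suc e) 2) (≤-trans (n≤1+n _) (subst (_≤ r) d≡2e+1 d≤r)))
    w<r : r ∸ suc e < r
    w<r = subst (r ∸ suc e <_) w+e+1≡r (m<m+n (r ∸ suc e) (s≤s z≤n))
    wrap : (r ∸ suc e) * 2 + suc (suc e * 2) ≡ 1 * n
    wrap = begin
      (r ∸ suc e) * 2 + suc (suc e * 2)   ≡⟨ +-suc ((r ∸ suc e) * 2) (suc e * 2) ⟩
      suc ((r ∸ suc e) * 2 + suc e * 2)   ≡⟨ cong suc (*-distribʳ-+ 2 (r ∸ suc e) (suc e)) ⟨
      suc ((r ∸ suc e + suc e) * 2)       ≡⟨ cong (λ x → suc (x * 2)) w+e+1≡r ⟩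
      suc (r * 2)                         ≡⟨ cong suc (*-comm r 2) ⟩
      suc (2 * r)                         ≡⟨ +-comm (2 * r) 1 ⟨
      2 * r + 1                           ≡⟨ odd ⟨
      n                                   ≡⟨ +-identityʳ n ⟨
      1 * n                               ∎

-- Given one set missing d, with gap z₀ and a pair at distance 1 starting at z₀ + t, every other
-- set missing d is a translate of it, so the same offset t works.
adjacent-offset : ∀ {n r} → n ≡ 2 * r + 1 → {m₀ : Fin n → Bool} {d : ℕ} → 2 ≤ d → d ≤ r →
  Large r m₀ → Misses m₀ d →
  ∃ λ t → ∀ {m z} → Alternates m d z → m (z ⊕ t) ≡ true × m (z ⊕ t ⊕ 1) ≡ true
adjacent-offset {n} {r} odd {m₀} {d} 2≤d d≤r large misses
  with any? (λ i → m₀ i Bool.≟ true ×-dec m₀ (i ⊕ 1) Bool.≟ true)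
... | no none = contradiction misses
  (misses-1⇒¬misses odd 2≤d d≤r large (λ i i∈ → ¬-not (λ i+∈ → none (i , i∈ , i+∈))))
... | yes (i , i∈ , i+∈) with misses⇒alternates odd large misses
... | z₀ , A₀ with ⊕-connects z₀ i
... | t , refl = t , λ {m} {z} A → transfer A (⊕-connects z z₀)
  where
  transfer : ∀ {m z} → Alternates m d z → (∃ λ k → z ⊕ k ≡ z₀) →
    m (z ⊕ t) ≡ true × m (z ⊕ t ⊕ 1) ≡ true
  transfer {m} {z} A (k , refl) =
    trans (same (z ⊕ t)) (trans (cong m₀ (⊕-comm z t k)) i∈) ,
    trans (same (z ⊕ t ⊕ 1))
      (trans (cong m₀ (trans (⊕-comm (z ⊕ t) 1 k) (cong (_⊕ 1) (⊕-comm z t k)))) i+∈)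
    where
    -- `z ⊕ k` is the gap of `m₀`, so `m₀` pulled back along the shift by `k` has gap `z` and must
    -- be `m`.
    same : ∀ x → m x ≡ m₀ (x ⊕ k)
    same = alternates-unique {r = r} odd A (alternates-translate k A₀)

-- Exchanging an unused hyperedge with the transversal

Unused : ∀ {k s} → (Fin k → Fin s) → Fin s → Set
Unused c h = ∀ i → c i ≢ h

-- A system of distinct representatives. For a fixed vertex sequence, the hyperedges of a Berge
-- cycle are one, with incidence as `Fits`.
record Transversal {k s} (Fits : Fin k → Fin s → Set) (c : Fin k → Fin s) : Set where
  field
    injective : Injective _≡_ _≡_ c
    fits      : ∀ i → Fits i (c i)

open Transversal

replace : ∀ {k s} → (Fin k → Fin s) → Fin k → Fin s → Fin k → Fin s
replace c i u = Vector.updateAt c i (const u)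

-- The only case split on `replace`; every later fact about an exchanged sequence is a choice of
-- `P`.
replace-elim : ∀ {k s} {c : Fin k → Fin s} {i u} (P : Fin k → Fin s → Set) →
  P i u → (∀ j → j ≢ i → P j (c j)) → ∀ j → P j (replace c i u j)
replace-elim {c = c} {i} P new old j with j ≟ i
... | yes refl = subst (P j) (sym (updateAt-updates j c)) new
... | no  j≢i  = subst (P j) (sym (updateAt-minimal j i c j≢i)) (old j j≢i)

replace-transversal : ∀ {k s} {Fits : Fin k → Fin s → Set} {c i u} →
  Transversal Fits c → Unused c u → Fits i u → Transversal Fits (replace c i u)
replace-transversal {Fits = Fits} {c} {i} {u} T fresh fit = record
  { injective = λ {j} {k} → replace-elim (λ j h → ∀ k → h ≡ replace c i u k → j ≡ k)
      (replace-elim (λ k h → u ≡ h → i ≡ k) (λ _ → refl) (λ k _ eq → contradiction (sym eq) (fresh k)))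
      (λ j _ → replace-elim (λ k h → c j ≡ h → j ≡ k) (λ eq → contradiction eq (fresh j)) (λ k _ → injective T))
      j k
  ; fits = replace-elim Fits fit (λ j _ → fits T j)
  }

-- `Q` is the property sought, and `Slot` assigns a place to each hyperedge of `𝒢` lacking it.
-- Injectivity of `Slot` is what makes the exchange terminate.
module Exchange {k s} (Fits : Fin k → Fin s → Set) (𝒢 Q : Fin s → Set) (Q? : Decidable Q)
  (fits⇒𝒢 : ∀ {i h} → Fits i h → 𝒢 h)
  (Slot : Fin s → Fin k → Set)
  (slot : ∀ {h} → 𝒢 h → ¬ Q h → ∃ (Slot h))
  (slot⇒fits : ∀ {h i} → Slot h i → Fits i h)
  (slot-injective : ∀ {h h′ i} → Slot h i → Slot h′ i → h ≡ h′)
  where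

  record Result (c : Fin k → Fin s) (u : Fin s) : Set where
    field
      c′          : Fin k → Fin s
      u′          : Fin s
      transversal : Transversal Fits c′
      u′∈𝒢        : 𝒢 u′
      Q-u′        : Q u′
      u′-unused   : Unused c′ u′
      -- Here `w` stands for a hyperedge chosen for another distance, which must stay off the cycle
      -- and differ from the new choice.
      preserves   : ∀ {w} → Unused c w → w ≢ u → Unused c′ w × w ≢ u′

  -- P collects the slots i whose hyperedge has been put there by the exchange; by injectivity of
  -- Slot such a slot is never used again.
  exchange : ∀ (P : Subset k) → Acc _⊃_ P → ∀ c u → Transversal Fits c → 𝒢 u → Unused c u →
    (∀ i → i ∈ P → Slot (c i) i) → Result c u
  exchange P (acc rec) c u T u∈𝒢 fresh settled with Q? u
  ... | yes q = record
    { c′ = c ; u′ = u ; transversal = T ; u′∈𝒢 = u∈𝒢 ; Q-u′ = q ; u′-unused = fresh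
    ; preserves = _,_ }
  ... | no ¬q with slot u∈𝒢 ¬q
  ... | i , σ = record
    { c′ = R.c′ ; u′ = R.u′ ; transversal = R.transversal ; u′∈𝒢 = R.u′∈𝒢 ; Q-u′ = R.Q-u′
    ; u′-unused = R.u′-unused
    -- Only `u` enters the cycle, and the displaced `c i` cannot be `w`, which was off the cycle.
    ; preserves = λ {w} unused w≢u → R.preserves
        (replace-elim (λ _ h → h ≢ w) (w≢u ∘ sym) (λ j _ → unused j)) (unused i ∘ sym) }
    where
    -- If slot `i` were settled, its occupant would share the slot with `u` and so equal `u`, which
    -- is off the cycle.
    i∉P : ¬ (i ∈ P)
    i∉P i∈P = fresh i (slot-injective (settled i i∈P) σ)
    module R = Result (exchange (P ∪ ⁅ i ⁆)
      (rec (p⊆p∪q ⁅ i ⁆ , i , q⊆p∪q P ⁅ i ⁆ (x∈⁅x⁆ i) , i∉P))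
      (replace c i u) (c i)
      (replace-transversal T fresh (slot⇒fits σ))
      (fits⇒𝒢 (fits T i))
      (replace-elim (λ _ h → h ≢ c i) (fresh i ∘ sym) (λ j j≢i → j≢i ∘ injective T))
      (replace-elim (λ j h → j ∈ P ∪ ⁅ i ⁆ → Slot h j) (λ _ → σ)
        (λ j j≢i j∈ → [ settled j , (λ j∈i → contradiction (x∈⁅y⁆⇒x≡y i j∈i) j≢i) ]′
          (x∈p∪q⁻ P ⁅ i ⁆ j∈))))

  augment : ∀ c u → Transversal Fits c → 𝒢 u → Unused c u → Result c u
  augment c u T u∈𝒢 fresh = exchange ∅ (⊃-wellFounded ∅) c u T u∈𝒢 fresh
    (λ _ i∈∅ → contradiction i∈∅ ∉⊥)

-- Berge cycles with a fixed vertex sequence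

module _ {n r : ℕ} (odd : n ≡ 2 * r + 1) (H : Hypergraph n) (v : Fin n → Fin n)
  (v-surjective : StrictlySurjective _≡_ v)
  (𝒢 : Subset (size H)) (𝒢-large : ∀ h → h ∈ 𝒢 → ∣ edge H h ∣ ≥ r) where

  position : Fin (size H) → Fin n → Bool
  position h i = lookup (edge H h) (v i)

  position-large : ∀ {h} → h ∈ 𝒢 → Large r (position h)
  position-large {h} h∈𝒢 = s , s-injective , λ j → []=⇒lookup
    (subst (_∈ edge H h) (sym (proj₂ (v-surjective (e j)))) (element-∈ (edge H h) (inject≤ j (𝒢-large h h∈𝒢))))
    where
    e : Fin r → Fin n
    e j = element (edge H h) (inject≤ j (𝒢-large h h∈𝒢))
    s : Fin r → Fin n
    s j = proj₁ (v-surjective (e j))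
    s-injective : Injective _≡_ _≡_ s
    s-injective {i} {j} eq = inject≤-injective _ _ i j (element-injective (edge H h)
      (trans (sym (proj₂ (v-surjective (e i)))) (trans (cong v eq) (proj₂ (v-surjective (e j))))))

  -- Every vertex has a position, so the positions determine the vertex set, and by simplicity the
  -- vertex set determines the hyperedge.
  position-determines : ∀ {h h′} → (∀ i → position h i ≡ position h′ i) → h ≡ h′
  position-determines same = simple H (⊆-antisym (included same) (included (sym ∘ same)))
    where
    included : ∀ {h h′} → (∀ i → position h i ≡ position h′ i) → ∀ {x} → x ∈ edge H h → x ∈ edge H h′
    included {h′ = h′} same {x} x∈h with v-surjective x
    ... | i , refl = lookup⇒[]= (v i) (edge H h′) (trans (sym (same i)) ([]=⇒lookup x∈h))

  realizes? : ∀ h d → Dec (Realizes v (edge H h) d)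
  realizes? h d = any? (λ i → v i ∈? edge H h ×-dec v (i ⊕ d) ∈? edge H h)

  ¬realizes⇒misses : ∀ {h d} → ¬ Realizes v (edge H h) d → Misses (position h) d
  ¬realizes⇒misses {h} {d} ¬realizes i i∈ = ¬-not λ i+∈ →
    ¬realizes (i , lookup⇒[]= (v i) (edge H h) i∈ , lookup⇒[]= (v (i ⊕ d)) (edge H h) i+∈)

  -- Membership in `𝒢` is included so that a hyperedge displaced from the cycle is again a
  -- candidate.
  Fits : Fin n → Fin (size H) → Set
  Fits i h = h ∈ 𝒢 × (v i ∈ edge H h × v (i ⊕ 1) ∈ edge H h)

  record Realized {k} (c : Fin n → Fin (size H)) (δ : Fin k → ℕ) : Set where
    field
      c′          : Fin n → Fin (size H)
      transversal : Transversal Fits c′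
      g           : Fin k → Fin (size H)
      g-injective : Injective _≡_ _≡_ g
      g-∈         : ∀ j → g j ∈ 𝒢
      g-unused    : ∀ j → Unused c′ (g j)
      g-realizes  : ∀ j → Realizes v (edge H (g j)) (δ j)

  realize-one : ∀ {c u d} → 2 ≤ d → d ≤ r → Transversal Fits c → u ∈ 𝒢 → Unused c u →
    ∃₂ λ c′ u′ → Transversal Fits c′ × u′ ∈ 𝒢 × Realizes v (edge H u′) d × Unused c′ u′ ×
      (∀ {w} → Unused c w → w ≢ u → Unused c′ w × w ≢ u′)
  realize-one {c} {u} {d} 2≤d d≤r T u∈𝒢 fresh with realizes? u d
  ... | yes realizes = c , u , T , u∈𝒢 , realizes , fresh , _,_
  ... | no ¬realizes
    -- `u` itself is the sample set that yields the offset `t`, which then stays fixed for the whole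
    -- exchange.
    with adjacent-offset odd 2≤d d≤r (position-large u∈𝒢) (¬realizes⇒misses ¬realizes)
  ... | t , adjacent =
    R.c′ , R.u′ , R.transversal , R.u′∈𝒢 , R.Q-u′ , R.u′-unused , R.preserves
    where
    Slot : Fin (size H) → Fin n → Set
    Slot h i = h ∈ 𝒢 × (∃ λ z → Alternates (position h) d z × z ⊕ t ≡ i)
    slot : ∀ {h} → h ∈ 𝒢 → ¬ Realizes v (edge H h) d → ∃ (Slot h)
    slot h∈𝒢 ¬realizes with misses⇒alternates odd (position-large h∈𝒢) (¬realizes⇒misses ¬realizes)
    ... | z , A = z ⊕ t , h∈𝒢 , z , A , refl
    slot⇒fits : ∀ {h i} → Slot h i → Fits i h
    slot⇒fits {h} (h∈𝒢 , z , A , refl) with adjacent A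
    ... | i∈ , i+∈ = h∈𝒢 , lookup⇒[]= (v (z ⊕ t)) (edge H h) i∈ , lookup⇒[]= (v (z ⊕ t ⊕ 1)) (edge H h) i+∈
    -- With a common offset, equal slots mean equal gaps, and the gap determines the hyperedge.
    slot-injective : ∀ {h h′ i} → Slot h i → Slot h′ i → h ≡ h′
    slot-injective (_ , z , A , refl) (_ , z′ , A′ , eq) with ⊕-injective t {z′} {z} eq
    ... | refl = position-determines (alternates-unique {r = r} odd A A′)
    module R = Exchange.Result (Exchange.augment Fits (_∈ 𝒢) (λ h → Realizes v (edge H h) d) (λ h → realizes? h d)
      proj₁ Slot slot slot⇒fits slot-injective c u T u∈𝒢 fresh)

  -- Induction on the number of distances: the tail of `δ` is treated first, and a further exchange
  -- realizes its head without disturbing the earlier choices.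
  realize-all : ∀ {c} k (δ : Fin k → ℕ) → (∀ j → 2 ≤ δ j) → (∀ j → δ j ≤ r) → n + k ≤ ∣ 𝒢 ∣ →
    Transversal Fits c → Realized c δ
  realize-all {c} zero δ δ≥2 δ≤r n+k≤𝒢 T = record
    { c′ = c ; transversal = T ; g = λ () ; g-injective = λ { {()} } ; g-∈ = λ () ; g-unused = λ ()
    ; g-realizes = λ () }
  realize-all (suc k) δ δ≥2 δ≤r n+k≤𝒢 T
    with n+k<𝒢 ← subst (_≤ ∣ 𝒢 ∣) (+-suc n k) n+k≤𝒢
    with record { c′ = c ; transversal = T ; g = g ; g-injective = g-injective ; g-∈ = g-∈
                ; g-unused = g-unused ; g-realizes = g-realizes }
      ← realize-all k (δ ∘ suc) (δ≥2 ∘ suc) (δ≤r ∘ suc) (<⇒≤ n+k<𝒢) T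
    -- The cycle occupies `n` hyperedges and the earlier choices `k`, which together are fewer than
    -- `𝒢` contains.
    with u , u∈𝒢 , fresh ← ∃-outside-image (c Vector.++ g) 𝒢 n+k<𝒢
    with c′ , u′ , T′ , u′∈𝒢 , u′-realizes , u′-unused , preserves
      ← realize-one (δ≥2 zero) (δ≤r zero) T u∈𝒢
          (λ i eq → fresh (i ↑ˡ k) (trans (cong [ c , g ]′ (splitAt-↑ˡ n i k)) eq))
    = record
    { c′ = c′ ; transversal = T′ ; g = u′ Vector.∷ g
    ; g-injective = ∷-injective g-injective (proj₂ ∘ keep)
    ; g-∈        = λ { zero → u′∈𝒢 ; (suc j) → g-∈ j }
    ; g-unused   = λ { zero → u′-unused ; (suc j) → proj₁ (keep j) }
    ; g-realizes = λ { zero → u′-realizes ; (suc j) → g-realizes j } }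
    where
    keep : ∀ j → Unused c′ (g j) × g j ≢ u′
    keep j = preserves (g-unused j) λ eq →
      fresh (n ↑ʳ j) (trans (cong [ c , g ]′ (splitAt-↑ʳ n k j)) eq)

theorem1p3 : ∀ (n r : ℕ) → n ≡ 2 * r + 1 → n ≥ 5 →
    (H : Hypergraph n) (C : BergeCycle H n) → Hamiltonian C →
    (𝒢 : Subset (size H)) → E C ⊆ (_∈ 𝒢) →
    (∀ h → h ∈ 𝒢 → ∣ edge H h ∣ ≥ r) →
    (D : Subset (suc r)) → (∀ d → d ∈ D → 2 ≤ toℕ d) →
    ∣ 𝒢 ∣ ≥ n + ∣ D ∣ →
    Σ[ C′ ∈ BergeCycle H n ]
    (Hamiltonian C′ ×
    (∀ i → vertex C′ i ≡ vertex C i) ×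
    E C′ ⊆ (_∈ 𝒢) ×
    (Σ[ g ∈ (∀ d → d ∈ D → Fin (size H)) ]
    ((∀ d d′ (p : d ∈ D) (p′ : d′ ∈ D) → g d p ≡ g d′ p′ → d ≡ d′) ×
    (∀ d (p : d ∈ D) →
    g d p ∈ 𝒢 ×
    g d p ∉ E C′ ×
    Realizes (vertex C) (edge H (g d p)) (toℕ d)))))
theorem1p3 n r odd _ H C hamiltonian 𝒢 EC⊆𝒢 𝒢-large D D≥2 n+D≤𝒢 =
  record
    { length≥2            = length≥2 C
    ; vertex              = vertex C
    ; hyperedge           = R.c′
    ; vertex-injective    = vertex-injective C
    ; hyperedge-injective = injective R.transversal
    ; incident            = λ i → proj₂ (fits R.transversal i)
    } ,
  hamiltonian ,
  (λ _ → refl) ,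
  (λ { (i , refl) → proj₁ (fits R.transversal i) }) ,
  -- `index p` is the rank of the distance within `D`; `element D` recovers the distance from it, so
  -- distinctness by rank gives distinctness by distance.
  (λ _ p → R.g (index p)) ,
  (λ _ _ p p′ eq → trans (sym (element-index p))
    (trans (cong (element D) (R.g-injective eq)) (element-index p′))) ,
  λ d p → R.g-∈ (index p) ,
    (λ (i , eq) → R.g-unused (index p) i eq) ,
    subst (Realizes (vertex C) (edge H (R.g (index p))) ∘ toℕ) (element-index p) (R.g-realizes (index p))
  where
  hyperedges : Transversal (Fits odd H (vertex C) hamiltonian 𝒢 𝒢-large) (hyperedge C)
  hyperedges = record { injective = hyperedge-injective C ; fits = λ i → EC⊆𝒢 (i , refl) , incident C i }
  module R = Realized (realize-all odd H (vertex C) hamiltonian 𝒢 𝒢-large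
    ∣ D ∣ (toℕ ∘ element D) (λ j → D≥2 _ (element-∈ D j)) (λ j → toℕ≤pred[n] (element D j)) n+D≤𝒢
    hyperedges)
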